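{- For $n\ge1$ and $r\ge1$, the number of connected skew diagrams (counted up to translation, i.e. as parallelogram polyominoes) of perimeter $2n+2$ and rank $r$ equals \[2^{\,n+1-2r}\binom{n-1}{2r-2}C_{r-1}.\]
   Context: For partitions $\mu\subseteq\lambda$, the skew diagram $\lambda/\mu$ is the set of cells $(i,j)$ (row $i$, column $j$, English convention, rows numbered downwards) with $\mu_i<j\le\lambda_i$. It is connected if its cells form an edge-connected nonempty set; connected skew diagrams, up to translation, are exactly the parallelogram polyominoes. Its perimeter is its boundary length, i.e. $2\times$(number of nonempty rows + number of nonempty columns). A cell $(i,j)$ of $\lambda/\mu$ is an outside top corner if neither $(i-1,j)$ nor $(i,j-1)$ lies in $\lambda/\mu$; it is an inside top corner if both $(i-1,j)$ and $(i,j-1)$ lie in $\lambda/\mu$ but $(i-1,j-1)$ does not. The diagonal starting at a cell $(i,j)$ is the set of cells $(i+t,j+t)$, $t\ge0$, that lie in $\lambda/\mu$ for all $t'\le t$. The rank of $\lambda/\mu$ is the total number of cells on diagonals starting at outside top corners minus the total number of cells on diagonals starting at inside top corners. $C_m=\frac{1}{m+1}\binom{2m}{m}$ is the Catalan number. -}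

module Defs where

open import Data.Nat using (ℕ; zero; suc; _+_; _*_; _∸_; _≤_; _<_; _≥_; _<?_; _≤?_; _/_)
open import Data.Nat.Combinatorics using (_C_)
open import Data.Integer as ℤ using (ℤ; +_)
open import Data.Bool using (Bool; true; false; _∧_; not; if_then_else_)
open import Data.List using (List; []; _∷_; length; last; map; applyUpTo; filter)
open import Data.Nat.ListAction using (sum)
open import Data.List.Relation.Unary.All using (All)
open import Data.List.Relation.Unary.Linked using (Linked)
open import Data.List.Relation.Binary.Pointwise using (Pointwise)
open import Data.Maybe using (Maybe; just)
open import Data.Product using (_×_; _,_)
open import Data.Sum using (_⊎_)
open import Relation.Binary.PropositionalEquality using (_≡_)
open import Relation.Nullary.Decidable using (⌊_⌋)

catalan : ℕ → ℕ
catalan m = ((2 * m) C m) / suc m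

-- Partitions as lists of parts; part p i = p_i (rows numbered from 1),
-- with p_i = 0 for i = 0 or i beyond the list (partitions padded by 0).

part : List ℕ → ℕ → ℕ
part []       _             = 0
part (x ∷ xs) zero          = 0
part (x ∷ xs) (suc zero)    = x
part (x ∷ xs) (suc (suc i)) = part xs (suc i)

-- Cells are pairs (row i, column j), English convention.
Cell : Set
Cell = ℕ × ℕ

InSkew : List ℕ → List ℕ → Cell → Set
InSkew lam mu (i , j) = (part mu i < j) × (j ≤ part lam i)

inSkew : List ℕ → List ℕ → ℕ → ℕ → Bool
inSkew lam mu i j = ⌊ part mu i <? j ⌋ ∧ ⌊ j ≤? part lam i ⌋

Adjacent : Cell → Cell → Set
Adjacent (i , j) (i' , j') =
  ((i ≡ i') × ((suc j ≡ j') ⊎ (j ≡ suc j'))) ⊎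
  ((j ≡ j') × ((suc i ≡ i') ⊎ (i ≡ suc i')))

data Path (D : Cell → Set) : Cell → Cell → Set where
  stop : ∀ {c} → Path D c c
  step : ∀ {c d e} → Adjacent c d → D d → Path D d e → Path D c e

-- a set of cells is edge-connected (nonemptiness is imposed separately)
EdgeConnected : (Cell → Set) → Set
EdgeConnected D = ∀ c c' → D c → D c' → Path D c c'

-- Connected skew diagrams up to translation, via canonical representatives:
-- λ/μ with λ = (λ_1 ≥ … ≥ λ_k > 0), μ = (μ_1 ≥ … ≥ μ_k ≥ 0) of the same
-- length k, every row 1..k nonempty (μ_i < λ_i, hence μ ⊆ λ), and μ_k = 0
-- (so the diagram occupies row 1 and column 1).  Every connected skew
-- diagram is a translate of exactly one such λ/μ.  Proof fields are
-- irrelevant so that the type counts diagrams, not proofs.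

record ConnectedSkew : Set where
  constructor mkCS
  field
    lam : List ℕ
    mu  : List ℕ
    .lam-partition : Linked _≥_ lam × All (0 <_) lam
    .mu-partition  : Linked _≥_ mu
    .rows-nonempty : Pointwise _<_ mu lam
    .normalised    : last mu ≡ just 0
    .connected     : EdgeConnected (InSkew lam mu)
open ConnectedSkew public

count : (ℕ → Bool) → List ℕ → ℕ
count p xs = length (filter (λ x → Data.Bool.T? (p x)) xs)
  where import Data.Bool

range1 : ℕ → List ℕ
range1 m = applyUpTo suc m

numRows numCols : ConnectedSkew → ℕ
-- nonempty rows i (only rows 1 .. length λ can be nonempty)
numRows D = count (λ i → ⌊ part (mu D) i <? part (lam D) i ⌋) (range1 (length (lam D)))
-- nonempty columns j (only columns 1 .. λ_1 can be nonempty)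
numCols D = count (λ j → anyRow (range1 (length (lam D))) j) (range1 (part (lam D) 1))
  where
  anyRow : List ℕ → ℕ → Bool
  anyRow []       j = false
  anyRow (i ∷ is) j = if inSkew (lam D) (mu D) i j then true else anyRow is j

perimeter : ConnectedSkew → ℕ
perimeter D = 2 * (numRows D + numCols D)

module _ (D : ConnectedSkew) where
  private
    m : ℕ → ℕ → Bool
    m = inSkew (lam D) (mu D)

  -- number of cells on the diagonal starting at (i , j); the fuel
  -- (number of rows + 1) exceeds any diagonal length.
  diagLen : ℕ → ℕ → ℕ → ℕ
  diagLen zero     i j = 0
  diagLen (suc f)  i j = if m i j then suc (diagLen f (suc i) (suc j)) else 0

  diag : ℕ → ℕ → ℕ
  diag i j = diagLen (suc (length (lam D))) i j

  outsideTop : ℕ → ℕ → Bool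
  outsideTop i j = m i j ∧ not (m (i ∸ 1) j) ∧ not (m i (j ∸ 1))

  insideTop : ℕ → ℕ → Bool
  insideTop i j = m i j ∧ m (i ∸ 1) j ∧ m i (j ∸ 1) ∧ not (m (i ∸ 1) (j ∸ 1))

  sumCells : (ℕ → ℕ → Bool) → ℕ
  sumCells p = sum (map (λ i → sum (map (λ j → if p i j then diag i j else 0)
                                       (range1 (part (lam D) 1))))
                        (range1 (length (lam D))))

  rank : ℤ
  rank = (+ sumCells outsideTop) ℤ.- (+ sumCells insideTop)

{-# OPTIONS --safe #-}
module Submission where

-- For a diagram λ/μ with k rows let A = {μᵢ + k − i} and B = {λᵢ + k − i}. These are
-- the positions of the vertical steps of the upper and lower boundary path, so they
-- live in {0, …, n}, where min A = 0 and max B = n, and connectedness says aᵢ ≤ bᵢ₊₁.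
-- Reading the positions n − 1, …, 1 and recording membership in A and in B gives a
-- Motzkin path with two colours of flat steps (in both sets or in none).
--
-- Both boundary paths are on the same diagonal at the same time, and the number of
-- cells of that diagonal between them changes by at most one per step. Summing the
-- corner contributions by parts therefore turns the rank into the number of vertical
-- upper steps that are simultaneous with a horizontal lower step, i.e. the number of
-- elements of A outside B, which is one more than the number of up steps of the Motzkin
-- path. Two-coloured Motzkin paths with n − 1 steps and r − 1 up steps are counted by
-- choosing the 2r − 2 non-flat steps, a Dyck path on them, and the colours of the rest.

open import Defs
open import Axiom.UniquenessOfIdentityProofs using (module Decidable⇒UIP)
open import Data.Bool using (Bool; true; false; if_then_else_; _∧_; not)
open import Data.Empty using (⊥; ⊥-elim)
open import Data.Fin using (Fin)
open import Data.Fin.Properties using (+↔⊎; 0↔⊥)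
import Data.Integer as ℤ
import Data.Integer.Properties as ℤₚ
open import Data.List using (List; []; _∷_; length; last; drop; map; applyUpTo)
open import Data.List.Properties using (∷-injectiveʳ; map-applyUpTo)
open import Data.List.Relation.Binary.Pointwise using (Pointwise; []; _∷_)
open import Data.List.Relation.Unary.All using (All; []; _∷_)
open import Data.List.Relation.Unary.Linked as Linked using (Linked; []; [-]; _∷_)
open import Data.Maybe using (just)
open import Data.Nat
open import Data.Nat.Combinatorics using (_C_; nCk+nC[k+1]≡[n+1]C[k+1]; nCk≡nC[n∸k]; nC1≡n)
open import Data.Nat.Combinatorics.Specification using (k>n⇒nCk≡0)
open import Data.Nat.DivMod using (m*n/n≡m)
open import Data.Nat.ListAction using (sum)
open import Data.Nat.Properties
open import Data.Nat.Tactic.RingSolver using (solve-∀)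
open import Data.Product using (Σ; _×_; _,_; proj₁; proj₂)
open import Data.Sum using (_⊎_; inj₁; inj₂)
open import Data.Sum.Function.Propositional using (_⊎-↔_)
open import Function using (_∘_)
open import Function.Bundles using (_↔_; mk↔ₛ′; mk⤖)
open import Function.Consequences.Propositional using (strictlySurjective⇒surjective)
open import Function.Construct.Composition using (_↔-∘_)
open import Function.Definitions using (Injective; StrictlySurjective)
open import Function.Properties.Bijection using (⤖⇒↔)
open import Relation.Binary.Definitions using (tri<; tri≈; tri>)
open import Relation.Binary.PropositionalEquality
open import Relation.Nullary using (Dec; yes; no; ¬_; does; _×-dec_)
open import Relation.Nullary.Decidable using (⌊_⌋; dec-true; dec-false; map′; recompute)

-- Two-coloured Motzkin paths and their recursive count.

-- Two-coloured Motzkin paths from height h to 0 with n steps. The step at position n tells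
-- whether n lies in both A and B, in none of them, only in B (up) or only in A (down).
data Word : ℕ → ℕ → Set where
  nil  : Word 0 0
  both : ∀ {h n} → Word h n → Word h (suc n)
  none : ∀ {h n} → Word h n → Word h (suc n)
  up   : ∀ {h n} → Word (suc h) n → Word h (suc n)
  down : ∀ {h n} → Word h n → Word (suc h) (suc n)

ups : ∀ {h n} → Word h n → ℕ
ups nil      = 0
ups (both w) = ups w
ups (none w) = ups w
ups (up w)   = suc (ups w)
ups (down w) = ups w

WordUps : ℕ → ℕ → ℕ → Set
WordUps h n k = Σ (Word h n) (λ w → ups w ≡ k)

-- The sum is bracketed like the disjoint union in `firstLetter`, so that `+↔⊎` alone takes it
-- apart.
mutual
  #words : ℕ → ℕ → ℕ → ℕ
  #words zero    zero    zero    = 1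
  #words zero    zero    (suc _) = 0
  #words (suc _) zero    _       = 0
  #words h       (suc n) k       = (#words h n k + #words h n k) + (#up h n k + #down h n k)

  #up #down : ℕ → ℕ → ℕ → ℕ
  #up h n zero    = 0
  #up h n (suc k) = #words (suc h) n k
  #down zero    n k = 0
  #down (suc h) n k = #words h n k

AfterUp AfterDown : ℕ → ℕ → ℕ → Set
AfterUp h n zero    = ⊥
AfterUp h n (suc k) = WordUps (suc h) n k
AfterDown zero    n k = ⊥
AfterDown (suc h) n k = WordUps h n k

firstLetter : ∀ h n k →
  ((WordUps h n k ⊎ WordUps h n k) ⊎ (AfterUp h n k ⊎ AfterDown h n k)) ↔ WordUps h (suc n) k
firstLetter h n k = mk↔ₛ′ join split join-split split-join
  where
  consUp : ∀ k → AfterUp h n k → WordUps h (suc n) k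
  consUp (suc _) (w , refl) = up w , refl
  consDown : ∀ h → AfterDown h n k → WordUps h (suc n) k
  consDown (suc _) (w , e) = down w , e
  join : (WordUps h n k ⊎ WordUps h n k) ⊎ (AfterUp h n k ⊎ AfterDown h n k) → WordUps h (suc n) k
  join (inj₁ (inj₁ (w , e))) = both w , e
  join (inj₁ (inj₂ (w , e))) = none w , e
  join (inj₂ (inj₁ x))       = consUp k x
  join (inj₂ (inj₂ x))       = consDown h x
  split : ∀ {h k} → WordUps h (suc n) k → (WordUps h n k ⊎ WordUps h n k) ⊎ (AfterUp h n k ⊎ AfterDown h n k)
  split (both w , e)  = inj₁ (inj₁ (w , e))
  split (none w , e)  = inj₁ (inj₂ (w , e))
  split (up w , refl) = inj₂ (inj₁ (w , refl))
  split (down w , e)  = inj₂ (inj₂ (w , e))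
  join-split : ∀ x → join (split x) ≡ x
  join-split (both w , e)  = refl
  join-split (none w , e)  = refl
  join-split (up w , refl) = refl
  join-split (down w , e)  = refl
  split-consUp : ∀ k x → split (consUp k x) ≡ inj₂ (inj₁ x)
  split-consUp (suc _) (w , refl) = refl
  split-consDown : ∀ h x → split (consDown h x) ≡ inj₂ (inj₂ x)
  split-consDown (suc _) (w , e) = refl
  split-join : ∀ x → split (join x) ≡ x
  split-join (inj₁ (inj₁ (w , e))) = refl
  split-join (inj₁ (inj₂ (w , e))) = refl
  split-join (inj₂ (inj₁ x))       = split-consUp k x
  split-join (inj₂ (inj₂ x))       = split-consDown h x

mutual
  Fin↔WordUps : ∀ h n k → Fin (#words h n k) ↔ WordUps h n k
  Fin↔WordUps zero zero zero = mk↔ₛ′ (λ _ → nil , refl) (λ _ → Fin.zero)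
    (λ { (nil , refl) → refl }) (λ { Fin.zero → refl ; (Fin.suc ()) })
  Fin↔WordUps zero    zero (suc k) = mk↔ₛ′ (λ ()) (λ { (nil , ()) }) (λ { (nil , ()) }) (λ ())
  Fin↔WordUps (suc h) zero k       = mk↔ₛ′ (λ ()) (λ { (() , _) }) (λ { (() , _) }) (λ ())
  -- `#words` unfolds at `suc n` only once `h` is a constructor, hence two clauses.
  Fin↔WordUps zero    (suc n) k    = Fin↔step zero n k
  Fin↔WordUps (suc h) (suc n) k    = Fin↔step (suc h) n k

  Fin↔step : ∀ h n k →
    Fin ((#words h n k + #words h n k) + (#up h n k + #down h n k)) ↔ WordUps h (suc n) k
  Fin↔step h n k = firstLetter h n k ↔-∘
    ((((Fin↔WordUps h n k ⊎-↔ Fin↔WordUps h n k) ↔-∘ +↔⊎)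
      ⊎-↔ ((Fin↔AfterUp h n k ⊎-↔ Fin↔AfterDown h n k) ↔-∘ +↔⊎)) ↔-∘ +↔⊎)

  Fin↔AfterUp : ∀ h n k → Fin (#up h n k) ↔ AfterUp h n k
  Fin↔AfterUp h n zero    = 0↔⊥
  Fin↔AfterUp h n (suc k) = Fin↔WordUps (suc h) n k

  Fin↔AfterDown : ∀ h n k → Fin (#down h n k) ↔ AfterDown h n k
  Fin↔AfterDown zero    n k = 0↔⊥
  Fin↔AfterDown (suc h) n k = Fin↔WordUps h n k

-- Closed formula: binomials, powers of two, Catalan numbers.

-- The number of non-flat steps of a path from height h to 0 with k up steps.
nonflat : ℕ → ℕ → ℕ
nonflat h zero    = h
nonflat h (suc k) = suc (suc (nonflat h k))

nonflat-suc : ∀ h k → nonflat (suc h) k ≡ suc (nonflat h k)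
nonflat-suc h zero    = refl
nonflat-suc h (suc k) = cong (λ x → suc (suc x)) (nonflat-suc h k)

nonflat≡ : ∀ h k → nonflat h k ≡ 2 * k + h
nonflat≡ h zero    = refl
nonflat≡ h (suc k) = trans (cong (λ x → suc (suc x)) (nonflat≡ h k)) (lem k h)
  where
  lem : ∀ k h → suc (suc (2 * k + h)) ≡ 2 * suc k + h
  lem = solve-∀

-- Paths from height h to 0 with k up steps and no flat steps.
ballot : ℕ → ℕ → ℕ
ballot zero    zero    = 1
ballot (suc h) zero    = ballot h zero
ballot zero    (suc k) = ballot 1 k
ballot (suc h) (suc k) = ballot (suc (suc h)) k + ballot h (suc k)

-- The choices of `j` non-flat positions among `n` steps, with one of two colours for each remaining
-- step.
choose2 : ℕ → ℕ → ℕ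
choose2 n j = 2 ^ (n ∸ j) * (n C j)

-- Conditioning on one step: flat in either colour, or non-flat. Truncated subtraction forces the
-- case split: for `i ≥ n` the exponent no longer drops, but then `n C suc i` is 0.
choose2-pascal : ∀ n i → choose2 n (suc i) + choose2 n (suc i) + choose2 n i ≡ choose2 (suc n) (suc i)
choose2-pascal n i with i <? n
... | yes i<n = begin
  2 ^ (n ∸ suc i) * c′ + 2 ^ (n ∸ suc i) * c′ + 2 ^ (n ∸ i) * c
    ≡⟨ cong (λ x → 2 ^ (n ∸ suc i) * c′ + 2 ^ (n ∸ suc i) * c′ + 2 ^ x * c) eq ⟩
  2 ^ (n ∸ suc i) * c′ + 2 ^ (n ∸ suc i) * c′ + 2 * 2 ^ (n ∸ suc i) * c
    ≡⟨ lem (2 ^ (n ∸ suc i)) c c′ ⟩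
  2 * 2 ^ (n ∸ suc i) * (c + c′)
    ≡⟨ cong₂ (λ x y → 2 ^ x * y) (sym eq) (nCk+nC[k+1]≡[n+1]C[k+1] n i) ⟩
  choose2 (suc n) (suc i) ∎
  where
  open ≡-Reasoning
  c  = n C i
  c′ = n C suc i
  eq : n ∸ i ≡ suc (n ∸ suc i)
  eq = +-∸-assoc 1 i<n
  lem : ∀ p c c′ → p * c′ + p * c′ + 2 * p * c ≡ 2 * p * (c + c′)
  lem = solve-∀
... | no i≮n = begin
  p * (n C suc i) + p * (n C suc i) + 2 ^ (n ∸ i) * (n C i)
    ≡⟨ cong (λ x → p * x + p * x + 2 ^ (n ∸ i) * (n C i)) zro ⟩
  p * 0 + p * 0 + 2 ^ (n ∸ i) * (n C i)
    ≡⟨ cong (λ x → x + x + 2 ^ (n ∸ i) * (n C i)) (*-zeroʳ p) ⟩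
  2 ^ (n ∸ i) * (n C i)
    ≡⟨ cong (2 ^ (n ∸ i) *_) (trans (sym (+-identityʳ (n C i))) (cong (n C i +_) (sym zro))) ⟩
  2 ^ (n ∸ i) * (n C i + n C suc i)
    ≡⟨ cong (2 ^ (n ∸ i) *_) (nCk+nC[k+1]≡[n+1]C[k+1] n i) ⟩
  choose2 (suc n) (suc i) ∎
  where
  open ≡-Reasoning
  p = 2 ^ (n ∸ suc i)
  zro : n C suc i ≡ 0
  zro = k>n⇒nCk≡0 (s≤s (≮⇒≥ i≮n))

choose2-0 : ∀ n → choose2 n 0 ≡ 2 ^ n
choose2-0 n = *-identityʳ (2 ^ n)

choose2-step : ∀ n i b → choose2 n (suc i) * b + choose2 n (suc i) * b + choose2 n i * b
  ≡ choose2 (suc n) (suc i) * b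
choose2-step n i b = trans (lem (choose2 n (suc i)) (choose2 n i) b) (cong (_* b) (choose2-pascal n i))
  where
  lem : ∀ x y b → x * b + x * b + y * b ≡ (x + x + y) * b
  lem = solve-∀

-- The flat steps can be inserted independently of the shape of the others. In the induction a flat
-- first step keeps `nonflat`, an up or down step lowers it by one, and the recursion of `ballot`
-- separates these two.
#words≡ : ∀ h n k → #words h n k ≡ choose2 n (nonflat h k) * ballot h k
#words≡ zero    zero    zero    = refl
#words≡ zero    zero    (suc k) = refl
#words≡ (suc h) zero    k rewrite nonflat-suc h k = refl
#words≡ zero (suc n) zero
  rewrite #words≡ zero n zero | choose2-0 n | choose2-0 (suc n) = lem (2 ^ n)
  where
  lem : ∀ p → p * 1 + p * 1 + 0 ≡ 2 * p * 1
  lem = solve-∀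
#words≡ (suc h) (suc n) zero
  rewrite #words≡ (suc h) n zero | #words≡ h n zero = choose2-step n h (ballot h 0)
#words≡ zero (suc n) (suc k)
  rewrite #words≡ zero n (suc k) | #words≡ 1 n k | nonflat-suc 0 k
  | +-identityʳ (choose2 n (suc (nonflat 0 k)) * ballot 1 k)
  = choose2-step n (suc (nonflat 0 k)) (ballot 1 k)
#words≡ (suc h) (suc n) (suc k)
  rewrite #words≡ (suc h) n (suc k) | #words≡ (suc (suc h)) n k | #words≡ h n (suc k)
  | nonflat-suc (suc h) k | nonflat-suc h k
  | sym (*-distribˡ-+ (choose2 n (suc (suc (nonflat h k)))) (ballot (suc (suc h)) k) (ballot h (suc k)))
  = choose2-step n (suc (suc (nonflat h k))) _

ballot-0 : ∀ h → ballot h 0 ≡ 1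
ballot-0 zero    = refl
ballot-0 (suc h) = ballot-0 h

middle : ∀ k → suc (2 * k) C suc k ≡ suc (2 * k) C k
middle k = trans (nCk≡nC[n∸k] le) (cong (suc (2 * k) C_) eq)
  where
  le : suc k ≤ suc (2 * k)
  le = s≤s (m≤m+n k (k + 0))
  eq : 2 * k ∸ k ≡ k
  eq = trans (m+n∸m≡n k (k + 0)) (+-identityʳ k)

-- The reflection principle, with the subtraction moved to the other side.
ballot-reflection : ∀ h k →
  ballot h (suc k) + (nonflat h (suc k) C k) ≡ nonflat h (suc k) C suc k
ballot-reflection zero zero = refl
ballot-reflection (suc h) zero = begin
  ballot h 0 + ballot h 1 + 1           ≡⟨ cong (λ x → x + ballot h 1 + 1) (ballot-0 h) ⟩
  suc (ballot h 1 + 1)                  ≡⟨ cong suc (ballot-reflection h 0) ⟩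
  suc (suc (suc h) C 1)                 ≡⟨ nCk+nC[k+1]≡[n+1]C[k+1] (suc (suc h)) 0 ⟩
  suc (suc (suc h)) C 1                 ∎
  where open ≡-Reasoning
ballot-reflection zero (suc k) = begin
  ballot 1 (suc k) + (suc s C suc k)
    ≡⟨ cong (ballot 1 (suc k) +_) (sym (nCk+nC[k+1]≡[n+1]C[k+1] s k)) ⟩
  ballot 1 (suc k) + (s C k + s C suc k)
    ≡⟨ sym (+-assoc (ballot 1 (suc k)) _ _) ⟩
  ballot 1 (suc k) + (s C k) + s C suc k
    ≡⟨ cong (_+ s C suc k)
         (subst (λ x → ballot 1 (suc k) + (suc (suc x) C k) ≡ suc (suc x) C suc k)
           (nonflat-suc 0 k) (ballot-reflection 1 k)) ⟩
  s C suc k + s C suc k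
    ≡⟨ cong (s C suc k +_) (sym mid) ⟩
  s C suc k + s C suc (suc k)
    ≡⟨ nCk+nC[k+1]≡[n+1]C[k+1] s (suc k) ⟩
  suc s C suc (suc k) ∎
  where
  open ≡-Reasoning
  s = suc (suc (suc (nonflat 0 k)))
  s≡ : s ≡ suc (2 * suc k)
  s≡ = cong suc (trans (nonflat≡ 0 (suc k)) (+-identityʳ _))
  -- At height 0 there is no down step; the equality of the two middle entries of the odd row `s`
  -- stands in for its term.
  mid : s C suc (suc k) ≡ s C suc k
  mid = subst (λ x → x C suc (suc k) ≡ x C suc k) (sym s≡) (middle (suc k))
ballot-reflection (suc h) (suc k) = begin
  b₁ + b₂ + (suc s C suc k)
    ≡⟨ cong (b₁ + b₂ +_) (sym (nCk+nC[k+1]≡[n+1]C[k+1] s k)) ⟩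
  b₁ + b₂ + (s C k + s C suc k)
    ≡⟨ lem b₁ b₂ (s C k) (s C suc k) ⟩
  (b₁ + s C k) + (b₂ + s C suc k)
    ≡⟨ cong₂ _+_
         (subst (λ x → b₁ + (suc (suc x) C k) ≡ suc (suc x) C suc k)
           (nonflat-suc (suc h) k) (ballot-reflection (suc (suc h)) k))
         (subst (λ x → b₂ + (suc (suc (suc x)) C suc k) ≡ suc (suc (suc x)) C suc (suc k))
           (sym (nonflat-suc h k)) (ballot-reflection h (suc k))) ⟩
  s C suc k + s C suc (suc k)
    ≡⟨ nCk+nC[k+1]≡[n+1]C[k+1] s (suc k) ⟩
  suc s C suc (suc k) ∎
  where
  open ≡-Reasoning
  s  = suc (suc (suc (nonflat (suc h) k)))
  b₁ = ballot (suc (suc h)) (suc k)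
  b₂ = ballot h (suc (suc k))
  lem : ∀ a b c d → a + b + (c + d) ≡ (a + c) + (b + d)
  lem = solve-∀

absorption : ∀ n k → suc k * (suc n C suc k) ≡ suc n * (n C k)
absorption zero    zero    = refl
absorption zero    (suc k) = *-zeroʳ k
absorption (suc n) zero    = trans (+-identityʳ _) (trans (nC1≡n (suc (suc n))) (sym (*-identityʳ _)))
absorption (suc n) (suc k) = begin
  suc (suc k) * (suc (suc n) C suc (suc k))
    ≡⟨ cong (suc (suc k) *_) (sym (nCk+nC[k+1]≡[n+1]C[k+1] (suc n) (suc k))) ⟩
  suc (suc k) * (x + y)
    ≡⟨ split k x y ⟩
  x + (suc k * x + suc (suc k) * y)
    ≡⟨ cong (x +_) (cong₂ _+_ (absorption n k) (absorption n (suc k))) ⟩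
  x + (suc n * (n C k) + suc n * (n C suc k))
    ≡⟨ cong (x +_) (trans (sym (*-distribˡ-+ (suc n) (n C k) (n C suc k)))
         (cong (suc n *_) (nCk+nC[k+1]≡[n+1]C[k+1] n k))) ⟩
  suc (suc n) * x ∎
  where
  open ≡-Reasoning
  x = suc n C suc k
  y = suc n C suc (suc k)
  split : ∀ k x y → suc (suc k) * (x + y) ≡ x + (suc k * x + suc (suc k) * y)
  split = solve-∀

-- Reflection gives `b` as `X` minus `Y`. Since `suc K * Y ≡ K * X`, multiplying by `suc K` leaves a
-- single `X`.
suc*ballot : ∀ k → ballot 0 k * suc k ≡ (2 * k) C k
suc*ballot zero    = refl
suc*ballot (suc k) = +-cancelʳ-≡ (K * X) (b * suc K) X (begin
  b * suc K + K * X       ≡⟨ cong (b * suc K +_) (sym KX) ⟩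
  b * suc K + suc K * Y   ≡⟨ lem b K Y ⟩
  suc K * (b + Y)         ≡⟨ cong (suc K *_) reflection ⟩
  suc K * X               ∎)
  where
  open ≡-Reasoning
  K = suc k
  N = 2 * K
  X = N C K
  Y = N C k
  b = ballot 0 K
  lem : ∀ b K Y → b * suc K + suc K * Y ≡ suc K * (b + Y)
  lem = solve-∀
  reflection : b + Y ≡ X
  reflection = subst (λ n → b + (n C k) ≡ n C K)
    (trans (nonflat≡ 0 K) (+-identityʳ _)) (ballot-reflection 0 k)
  N≡ : N ≡ suc (suc (2 * k))
  N≡ = cong suc (+-suc k (k + 0))
  Y≡ : Y ≡ N C suc K
  Y≡ = trans (nCk≡nC[n∸k] (≤-trans (n≤1+n k) (m≤m+n K (K + 0)))) (cong (N C_)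
    (trans (cong (_∸ k) (reorder k)) (m+n∸m≡n k (suc K))))
    where
    reorder : ∀ k → 2 * suc k ≡ k + suc (suc k)
    reorder = solve-∀
  -- `Y` is reflected across the centre of row `N`, absorbed into the odd row before it, where the
  -- two middle entries agree, and absorbed back.
  KX : suc K * Y ≡ K * X
  KX = begin
    suc K * Y                          ≡⟨ cong (suc K *_) Y≡ ⟩
    suc K * (N C suc K)                ≡⟨ cong (λ n → suc K * (n C suc K)) N≡ ⟩
    suc K * (suc (suc (2 * k)) C suc K) ≡⟨ absorption (suc (2 * k)) K ⟩
    suc (suc (2 * k)) * (suc (2 * k) C K) ≡⟨ cong (suc (suc (2 * k)) *_) (middle k) ⟩
    suc (suc (2 * k)) * (suc (2 * k) C k) ≡⟨ sym (absorption (suc (2 * k)) k) ⟩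
    K * (suc (suc (2 * k)) C K)        ≡⟨ cong (λ n → K * (n C K)) (sym N≡) ⟩
    K * X ∎

catalan≡ballot : ∀ k → catalan k ≡ ballot 0 k
catalan≡ballot k = trans (cong (_/ suc k) (sym (suc*ballot k))) (m*n/n≡m (ballot 0 k) (suc k))

#words-catalan : ∀ n k → #words 0 n k ≡ 2 ^ (n ∸ 2 * k) * (n C (2 * k)) * catalan k
#words-catalan n k = trans (#words≡ 0 n k)
  (cong₂ (λ j c → choose2 n j * c) (trans (nonflat≡ 0 k) (+-identityʳ _)) (sym (catalan≡ballot k)))

-- Paths as pairs of finite sets.

data Decr : ℕ → List ℕ → Set where
  []  : ∀ {m} → Decr m []
  _∷_ : ∀ {m x xs} → x < m → Decr x xs → Decr m (x ∷ xs)

Decr-weaken : ∀ {m n xs} → m ≤ n → Decr m xs → Decr n xs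
Decr-weaken m≤n []        = []
Decr-weaken m≤n (x<m ∷ d) = <-≤-trans x<m m≤n ∷ d

Decr-irrefl : ∀ {m xs ys} → Decr m ys → m ∷ xs ≢ ys
Decr-irrefl (x<m ∷ _) refl = <-irrefl refl x<m

-- After discarding its h largest elements and the final 0, A lies elementwise below B.
data Dominates : ℕ → List ℕ → List ℕ → Set where
  base  : Dominates 0 (0 ∷ []) []
  skip  : ∀ {h a A B} → Dominates h A B → Dominates (suc h) (a ∷ A) B
  match : ∀ {a b A B} → a ≤ b → Dominates 0 A B → Dominates 0 (a ∷ A) (b ∷ B)

pop : ∀ {h A b B} → Dominates h A (b ∷ B) → Dominates (suc h) A B
pop (skip d)    = skip (pop d)
pop (match _ d) = skip d

-- Enlarging `B` takes back one discarded element of `A`: the smallest discarded one is matched, and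
-- being below `m` is all this needs.
push : ∀ {h m A B} → Decr m A → Dominates (suc h) A B → Dominates h A (m ∷ B)
push {zero}  (a<m ∷ _) (skip d) = match (<⇒≤ a<m) d
push {suc h} (a<m ∷ D) (skip d) = skip (push (Decr-weaken (<⇒≤ a<m) D) d)

unskip : ∀ {h a A B} → Dominates (suc h) (a ∷ A) B → Dominates h A B
unskip (skip d) = d

-- The forced 0 of A closes `upper`. The forced maximum of B is left out of `lower` and put back in
-- `wordSkew`.
upper lower : ∀ {h n} → Word h n → List ℕ
upper nil              = 0 ∷ []
upper (both {n = n} w) = suc n ∷ upper w
upper (none w)         = upper w
upper (up w)           = upper w
upper (down {n = n} w) = suc n ∷ upper w
lower nil              = []
lower (both {n = n} w) = suc n ∷ lower w
lower (none w)         = lower w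
lower (up {n = n} w)   = suc n ∷ lower w
lower (down w)         = lower w

upper-Decr : ∀ {h n} (w : Word h n) → Decr (suc n) (upper w)
upper-Decr nil      = ≤-refl ∷ []
upper-Decr (both w) = ≤-refl ∷ upper-Decr w
upper-Decr (none w) = Decr-weaken (n≤1+n _) (upper-Decr w)
upper-Decr (up w)   = Decr-weaken (n≤1+n _) (upper-Decr w)
upper-Decr (down w) = ≤-refl ∷ upper-Decr w

lower-Decr : ∀ {h n} (w : Word h n) → Decr (suc n) (lower w)
lower-Decr nil      = []
lower-Decr (both w) = ≤-refl ∷ lower-Decr w
lower-Decr (none w) = Decr-weaken (n≤1+n _) (lower-Decr w)
lower-Decr (up w)   = ≤-refl ∷ lower-Decr w
lower-Decr (down w) = Decr-weaken (n≤1+n _) (lower-Decr w)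

push-both : ∀ {h m A B} → Decr m A → Dominates h A B → Dominates h (m ∷ A) (m ∷ B)
push-both {zero}  D d = match ≤-refl d
push-both {suc h} D d = skip (push D d)

dominates : ∀ {h n} (w : Word h n) → Dominates h (upper w) (lower w)
dominates nil      = base
dominates (both w) = push-both (upper-Decr w) (dominates w)
dominates (none w) = dominates w
dominates (up w)   = push (upper-Decr w) (dominates w)
dominates (down w) = skip (dominates w)

data Top (m : ℕ) : List ℕ → Set where
  present : ∀ {xs} → Decr m xs → Top m (m ∷ xs)
  absent  : ∀ {xs} → Decr m xs → Top m xs

top : ∀ {m xs} → Decr (suc m) xs → Top m xs
top []                = absent []
top {m} (_∷_ {x = x} x<1+m d) with x ≟ m
... | yes refl = present d
... | no x≢m   = absent (≤∧≢⇒< (s≤s⁻¹ x<1+m) x≢m ∷ d)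

¬Dominates-[] : ∀ {h B} → ¬ Dominates h [] B
¬Dominates-[] ()

-- Whether the top position lies in `A` and in `B` dictates the letter, and dominance at the new
-- height passes to the rest.
word-surjective : ∀ {h} n {A B} → Decr (suc n) A → Decr (suc n) B → Dominates h A B →
  Σ (Word h n) (λ w → upper w ≡ A × lower w ≡ B)
word-surjective zero dA dB base = nil , refl , refl
word-surjective zero (s≤s z≤n ∷ []) dB (skip d)    = ⊥-elim (¬Dominates-[] d)
word-surjective zero (s≤s z≤n ∷ []) dB (match _ d) = ⊥-elim (¬Dominates-[] d)
word-surjective {h} (suc n) dA dB d with top dA | top dB
... | present dA′ | present dB′ =
  -- Removing from `B` first raises the height, so `unskip` applies even when `h` is 0.
  let w , eA , eB = word-surjective n dA′ dB′ (unskip (pop d))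
  in both w , cong (suc n ∷_) eA , cong (suc n ∷_) eB
... | absent dA′ | absent dB′ =
  let w , eA , eB = word-surjective n dA′ dB′ d in none w , eA , eB
... | absent dA′ | present dB′ =
  let w , eA , eB = word-surjective n dA′ dB′ (pop d) in up w , eA , cong (suc n ∷_) eB
word-surjective {suc h} (suc n) dA dB d | present dA′ | absent dB′ =
  let w , eA , eB = word-surjective n dA′ dB′ (unskip d) in down w , cong (suc n ∷_) eA , eB
-- A down step at height 0 is impossible: the top position in `A` would need a partner at least as
-- large in `B`, where everything is smaller.
word-surjective {zero} (suc n) dA dB (match n≤b d) | present dA′ | absent (b<n ∷ _) =
  ⊥-elim (<⇒≱ b<n n≤b)

word-injective : ∀ {h n} (w w′ : Word h n) → upper w ≡ upper w′ → lower w ≡ lower w′ → w ≡ w′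
word-injective nil nil _ _ = refl
word-injective (both w) (both w′) p q = cong both (word-injective w w′ (∷-injectiveʳ p) (∷-injectiveʳ q))
word-injective (none w) (none w′) p q = cong none (word-injective w w′ p q)
word-injective (up w)   (up w′)   p q = cong up   (word-injective w w′ p (∷-injectiveʳ q))
word-injective (down w) (down w′) p q = cong down (word-injective w w′ (∷-injectiveʳ p) q)
word-injective (both w) (none w′) p q = ⊥-elim (Decr-irrefl (upper-Decr w′) p)
word-injective (both w) (up w′)   p q = ⊥-elim (Decr-irrefl (upper-Decr w′) p)
word-injective (both w) (down w′) p q = ⊥-elim (Decr-irrefl (lower-Decr w′) q)
word-injective (none w) (both w′) p q = ⊥-elim (Decr-irrefl (upper-Decr w) (sym p))
word-injective (none w) (up w′)   p q = ⊥-elim (Decr-irrefl (lower-Decr w) (sym q))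
word-injective (none w) (down w′) p q = ⊥-elim (Decr-irrefl (upper-Decr w) (sym p))
word-injective (up w)   (both w′) p q = ⊥-elim (Decr-irrefl (upper-Decr w) (sym p))
word-injective (up w)   (none w′) p q = ⊥-elim (Decr-irrefl (lower-Decr w′) q)
word-injective (up w)   (down w′) p q = ⊥-elim (Decr-irrefl (lower-Decr w′) q)
word-injective (down w) (both w′) p q = ⊥-elim (Decr-irrefl (lower-Decr w) (sym q))
word-injective (down w) (none w′) p q = ⊥-elim (Decr-irrefl (upper-Decr w′) p)
word-injective (down w) (up w′)   p q = ⊥-elim (Decr-irrefl (lower-Decr w) (sym q))

-- Elements of A outside B.

absence : ℕ → List ℕ → ℕ
absence v []       = 1
absence v (x ∷ xs) = if does (v ≟ x) then 0 else absence v xs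

absence-here : ∀ v xs → absence v (v ∷ xs) ≡ 0
absence-here v xs rewrite dec-true (v ≟ v) refl = refl

absence-there : ∀ {v x} xs → v ≢ x → absence v (x ∷ xs) ≡ absence v xs
absence-there {v} {x} xs v≢x rewrite dec-false (v ≟ x) v≢x = refl

absence-Decr : ∀ {m n xs} → Decr m xs → m ≤ n → absence n xs ≡ 1
absence-Decr []        m≤n = refl
absence-Decr {xs = x ∷ xs} (x<m ∷ d) m≤n = let x<n = <-≤-trans x<m m≤n in
  trans (absence-there xs (>⇒≢ x<n)) (absence-Decr d (<⇒≤ x<n))

absences : List ℕ → List ℕ → ℕ
absences []      B = 0
absences (a ∷ A) B = absence a B + absences A B

absences-top : ∀ {m A} B → Decr m A → absences A (m ∷ B) ≡ absences A B
absences-top B []        = refl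
absences-top {m} {a ∷ A} B (a<m ∷ d) =
  cong₂ _+_ (absence-there B (<⇒≢ a<m)) (absences-top B (Decr-weaken (<⇒≤ a<m) d))

-- Each down step puts one element into A but not B. Down steps outnumber up steps by `h`, and the
-- forced 0 of A gives the extra 1.
absences-word : ∀ {h n} (w : Word h n) → absences (upper w) (lower w) ≡ suc (ups w + h)
absences-word nil      = refl
absences-word (both w) = trans
  (cong₂ _+_ (absence-here _ (lower w)) (absences-top (lower w) (upper-Decr w)))
  (absences-word w)
absences-word (none w) = absences-word w
absences-word (up {h} w) = trans (absences-top (lower w) (upper-Decr w))
  (trans (absences-word w) (cong suc (+-suc (ups w) h)))
absences-word (down {h} w) = trans
  (cong₂ _+_ (absence-Decr (lower-Decr w) ≤-refl) (absences-word w))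
  (cong suc (sym (+-suc (ups w) h)))

-- Connectedness as overlap of consecutive rows.

-- Consecutive rows share a column: the local form of connectedness.
data Overlapping : List ℕ → List ℕ → Set where
  single : ∀ {l} → 0 < l → Overlapping (l ∷ []) (0 ∷ [])
  cons   : ∀ {l′ l m′ m ls ms} → l ≤ l′ → m ≤ m′ → m′ < l →
           Overlapping (l ∷ ls) (m ∷ ms) → Overlapping (l′ ∷ l ∷ ls) (m′ ∷ m ∷ ms)

-- Decidability lets `recompute` recover a usable proof from the irrelevant fields of a
-- `ConnectedSkew`.
overlapping? : ∀ ls ms → Dec (Overlapping ls ms)
overlapping? []            ms              = no λ ()
overlapping? (l ∷ ls)      []              = no λ ()
overlapping? (l ∷ [])      (zero ∷ [])     = map′ single (λ { (single p) → p }) (0 <? l)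
overlapping? (l ∷ [])      (suc m ∷ [])    = no λ ()
overlapping? (l ∷ [])      (m ∷ m′ ∷ ms)   = no λ ()
overlapping? (l ∷ l′ ∷ ls) (m ∷ [])        = no λ ()
overlapping? (l′ ∷ l ∷ ls) (m′ ∷ m ∷ ms)   = map′
  (λ { (p , q , r , o) → cons p q r o }) (λ { (cons p q r o) → p , q , r , o })
  (l ≤? l′ ×-dec m ≤? m′ ×-dec m′ <? l ×-dec overlapping? (l ∷ ls) (m ∷ ms))

Adjacent-sym : ∀ {c d} → Adjacent c d → Adjacent d c
Adjacent-sym (inj₁ (e , inj₁ p)) = inj₁ (sym e , inj₂ (sym p))
Adjacent-sym (inj₁ (e , inj₂ p)) = inj₁ (sym e , inj₁ (sym p))
Adjacent-sym (inj₂ (e , inj₁ p)) = inj₂ (sym e , inj₂ (sym p))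
Adjacent-sym (inj₂ (e , inj₂ p)) = inj₂ (sym e , inj₁ (sym p))

module _ {D : Cell → Set} where

  Path-trans : ∀ {c d e} → Path D c d → Path D d e → Path D c e
  Path-trans stop         q = q
  Path-trans (step a x p) q = step a x (Path-trans p q)

  Path-sym : ∀ {c d} → D c → Path D c d → Path D d c
  Path-sym x stop         = stop
  Path-sym x (step a y p) = Path-trans (Path-sym y p) (step (Adjacent-sym a) x stop)

¬InSkew-row0 : ∀ ls ms j → ¬ InSkew ls ms (0 , j)
¬InSkew-row0 []       []       j (p , q) = <⇒≱ p q
¬InSkew-row0 []       (_ ∷ _)  j (p , q) = <⇒≱ p q
¬InSkew-row0 (_ ∷ _)  []       j (p , q) = <⇒≱ p q
¬InSkew-row0 (_ ∷ _)  (_ ∷ _)  j (p , q) = <⇒≱ p q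

below : Cell → Cell
below (i , j) = suc i , j

Adjacent-below : ∀ {c d} → Adjacent c d → Adjacent (below c) (below d)
Adjacent-below (inj₁ (e , p))      = inj₁ (cong suc e , p)
Adjacent-below (inj₂ (e , inj₁ p)) = inj₂ (e , inj₁ (cong suc p))
Adjacent-below (inj₂ (e , inj₂ p)) = inj₂ (e , inj₂ (cong suc p))

module _ {ls ms : List ℕ} (l m : ℕ) where

  InSkew-below : ∀ c → InSkew ls ms c → InSkew (l ∷ ls) (m ∷ ms) (below c)
  InSkew-below (zero  , j) x = ⊥-elim (¬InSkew-row0 ls ms j x)
  InSkew-below (suc i , j) x = x

  Path-below : ∀ {c d} → Path (InSkew ls ms) c d → Path (InSkew (l ∷ ls) (m ∷ ms)) (below c) (below d)
  Path-below stop         = stop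
  Path-below (step a x p) = step (Adjacent-below a) (InSkew-below _ x) (Path-below p)

row-path : ∀ ls ms i j t → part ms i < j → j + t ≤ part ls i → Path (InSkew ls ms) (i , j + t) (i , j)
row-path ls ms i j zero    p q rewrite +-identityʳ j = stop
row-path ls ms i j (suc t) p q rewrite +-suc j t =
  step (inj₁ (refl , inj₂ refl)) (<-≤-trans p (m≤m+n j t) , <⇒≤ q) (row-path ls ms i j t p (<⇒≤ q))

row-path-≤ : ∀ ls ms i {j j′} → part ms i < j → j ≤ j′ → j′ ≤ part ls i → Path (InSkew ls ms) (i , j′) (i , j)
row-path-≤ ls ms i {j} p j≤j′ q =
  subst (λ x → Path (InSkew ls ms) (i , x) (i , j)) (m+[n∸m]≡n j≤j′)
    (row-path ls ms i j _ p (subst (_≤ part ls i) (sym (m+[n∸m]≡n j≤j′)) q))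

-- Every cell reaches the bottom left cell: go left to the start of the row, step down, repeat.
overlapping⇒connected : ∀ {ls ms} → Overlapping ls ms → EdgeConnected (InSkew ls ms)
overlapping⇒connected {ls} {ms} o c c′ x x′ =
  Path-trans (proj₂ (to-hub o) c x) (Path-sym x′ (proj₂ (to-hub o) c′ x′))
  where
  to-hub : ∀ {ls ms} → Overlapping ls ms →
    Σ Cell (λ hub → ∀ c → InSkew ls ms c → Path (InSkew ls ms) c hub)
  to-hub (single {l} 0<l) = (1 , 1) , go
    where
    go : ∀ c → InSkew (l ∷ []) (0 ∷ []) c → Path (InSkew (l ∷ []) (0 ∷ [])) c (1 , 1)
    go (zero , j)        x       = ⊥-elim (¬InSkew-row0 (l ∷ []) (0 ∷ []) j x)
    go (suc zero , j)    (p , q) = row-path-≤ (l ∷ []) (0 ∷ []) 1 (s≤s z≤n) p q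
    go (suc (suc i) , j) (p , q) = ⊥-elim (<⇒≱ p q)
  to-hub (cons {l′} {l} {m′} {m} {ls} {ms} l≤l′ m≤m′ m′<l o) = below hub , go
    where
    hub = proj₁ (to-hub o)
    Ls = l′ ∷ l ∷ ls
    Ms = m′ ∷ m ∷ ms
    go′ : ∀ c → InSkew (l ∷ ls) (m ∷ ms) c → Path (InSkew Ls Ms) (below c) (below hub)
    go′ c x = Path-below l′ m′ (proj₂ (to-hub o) c x)
    -- The cell under the leftmost cell of the first row.
    door : InSkew (l ∷ ls) (m ∷ ms) (1 , suc m′)
    door = s≤s m≤m′ , m′<l
    go : ∀ c → InSkew Ls Ms c → Path (InSkew Ls Ms) c (below hub)
    go (zero , j)        x       = ⊥-elim (¬InSkew-row0 Ls Ms j x)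
    go (suc zero , j)    (p , q) = Path-trans (row-path-≤ Ls Ms 1 ≤-refl p q)
      (step (inj₂ (refl , inj₁ refl)) door (go′ (1 , suc m′) door))
    go (suc (suc i) , j) x       = go′ (suc i , j) x

Decreasing : List ℕ → Set
Decreasing = Linked _≥_

-- An edge path can only leave rows ≤ i through a column common to rows i and i + 1.
connected⇒overlap : ∀ {ls ms} → EdgeConnected (InSkew ls ms) → ∀ i →
  part ms i < part ls i → part ms (suc i) < part ls (suc i) → part ms i < part ls (suc i)
connected⇒overlap {ls} {ms} conn i x y with part ms i <? part ls (suc i)
... | yes p = p
... | no ¬p = ⊥-elim (stuck ≤-refl (x , ≤-refl) (conn _ _ (x , ≤-refl) (y , ≤-refl)))
  where
  stuck : ∀ {a j j′} → a ≤ i → InSkew ls ms (a , j) → ¬ Path (InSkew ls ms) (a , j) (suc i , j′)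
  stuck a≤i _ stop = <-irrefl refl a≤i
  stuck a≤i _ (step (inj₁ (refl , _)) z q) = stuck a≤i z q
  stuck a≤i _ (step (inj₂ (refl , inj₂ refl)) z q) = stuck (<⇒≤ a≤i) z q
  stuck {a} a≤i w (step (inj₂ (refl , inj₁ refl)) z q) with m≤n⇒m<n∨m≡n a≤i
  ... | inj₁ a<i  = stuck a<i z q
  ... | inj₂ refl = ¬p (<-≤-trans (proj₁ w) (proj₂ z))

overlapping : ∀ {ls ms} → Decreasing ls → Decreasing ms → Pointwise _<_ ms ls → last ms ≡ just 0 →
  (∀ i → part ms i < part ls i → part ms (suc i) < part ls (suc i) → part ms i < part ls (suc i)) →
  Overlapping ls ms
overlapping [-] [-] (m<l ∷ []) refl ov = single m<l
overlapping (l≤l′ ∷ dl) (m≤m′ ∷ dm) (m′<l′ ∷ m<l ∷ pw) e ov =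
  cons l≤l′ m≤m′ (ov 1 m′<l′ m<l) (overlapping dl dm (m<l ∷ pw) e ov′)
  where
  ov′ : ∀ i → _
  -- Row 0 is empty because `part` is 0 there.
  ov′ zero    () _
  ov′ (suc i) p q = ov (suc (suc i)) p q

connectedSkew-overlapping : ∀ D → Overlapping (lam D) (mu D)
connectedSkew-overlapping (mkCS ls ms lp mp rn nm cn) =
  recompute (overlapping? ls ms) (overlapping (proj₁ lp) mp rn nm (connected⇒overlap {ls} {ms} cn))

overlapping⇒Pointwise : ∀ {ls ms} → Overlapping ls ms → Pointwise _<_ ms ls
overlapping⇒Pointwise (single p)       = p ∷ []
overlapping⇒Pointwise (cons p q r o) = <-≤-trans r p ∷ overlapping⇒Pointwise o

overlapping⇒lam-partition : ∀ {ls ms} → Overlapping ls ms → Decreasing ls × All (0 <_) ls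
overlapping⇒lam-partition (single p) = [-] , p ∷ []
overlapping⇒lam-partition (cons p q r o) = let d , a = overlapping⇒lam-partition o in
  p ∷ d , <-≤-trans (≤-<-trans z≤n r) p ∷ a

overlapping⇒mu-partition : ∀ {ls ms} → Overlapping ls ms → Decreasing ms
overlapping⇒mu-partition (single p)     = [-]
overlapping⇒mu-partition (cons p q r o) = q ∷ overlapping⇒mu-partition o

overlapping⇒normalised : ∀ {ls ms} → Overlapping ls ms → last ms ≡ just 0
overlapping⇒normalised (single p)     = refl
overlapping⇒normalised (cons p q r o) = overlapping⇒normalised o

fromOverlapping : ∀ ls ms → .(Overlapping ls ms) → ConnectedSkew
fromOverlapping ls ms o = mkCS ls ms (overlapping⇒lam-partition o) (overlapping⇒mu-partition o)
  (overlapping⇒Pointwise o) (overlapping⇒normalised o) (overlapping⇒connected o)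

ConnectedSkew-≡ : ∀ {D E} → lam D ≡ lam E → mu D ≡ mu E → D ≡ E
ConnectedSkew-≡ refl refl = refl

-- From partitions to sets of vertical steps and back.

-- The entry of row i of k is shifted by k − i, the number of rows below it.
β : List ℕ → List ℕ
β []       = []
β (x ∷ xs) = x + length xs ∷ β xs

unβ : List ℕ → List ℕ
unβ []       = []
unβ (x ∷ xs) = x ∸ length xs ∷ unβ xs

length-β : ∀ xs → length (β xs) ≡ length xs
length-β []       = refl
length-β (x ∷ xs) = cong suc (length-β xs)

length-unβ : ∀ xs → length (unβ xs) ≡ length xs
length-unβ []       = refl
length-unβ (x ∷ xs) = cong suc (length-unβ xs)

unβ-β : ∀ xs → unβ (β xs) ≡ xs
unβ-β []       = refl
unβ-β (x ∷ xs) = cong₂ _∷_ (trans (cong (x + length xs ∸_) (length-β xs)) (m+n∸n≡m x (length xs))) (unβ-β xs)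

-- Applied to the tail of a list, this makes the truncated subtraction in `unβ` exact.
Decr⇒length≤ : ∀ {m xs} → Decr m xs → length xs ≤ m
Decr⇒length≤ []        = z≤n
Decr⇒length≤ (x<m ∷ d) = ≤-<-trans (Decr⇒length≤ d) x<m

β-unβ : ∀ {m xs} → Decr m xs → β (unβ xs) ≡ xs
β-unβ [] = refl
β-unβ {xs = x ∷ xs} (_ ∷ d) = cong₂ _∷_
  (trans (cong (x ∸ length xs +_) (length-unβ xs)) (m∸n+n≡m (Decr⇒length≤ d))) (β-unβ d)

unβ-injective : ∀ {m n xs ys} → Decr m xs → Decr n ys → unβ xs ≡ unβ ys → xs ≡ ys
unβ-injective d e p = trans (sym (β-unβ d)) (trans (cong β p) (β-unβ e))

overlapping⇒length : ∀ {ls ms} → Overlapping ls ms → length ms ≡ length ls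
overlapping⇒length (single _)     = refl
overlapping⇒length (cons _ _ _ o) = cong suc (overlapping⇒length o)

dominates⇒length : ∀ {A B} → Dominates 0 A B → length A ≡ suc (length B)
dominates⇒length base        = refl
dominates⇒length (match _ d) = cong suc (dominates⇒length d)

-- The shifts of consecutive rows differ by one, so weak decrease becomes strict and the strict
-- `m′ < l` becomes the weak inequality of `match`. The forced maximum `l + length ls` of B appears
-- only as the bound.
β-overlapping : ∀ {l ls ms} → Overlapping (l ∷ ls) ms →
  Decr (l + length ls) (β ms) × Decr (l + length ls) (β ls) × Dominates 0 (β ms) (β ls)
β-overlapping {l} (single p) = subst (0 <_) (sym (+-identityʳ l)) p ∷ [] , [] , base
β-overlapping (cons {l′} {l} {m′} {m} {ls} {ms} l≤l′ m≤m′ m′<l o)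
  with β-overlapping o | overlapping⇒length o
... | _ ∷ dA , dB , d | e =
    +-mono-<-≤ (<-≤-trans m′<l l≤l′) (≤-reflexive e) ∷ +-mono-≤-< m≤m′ (n<1+n (length ms)) ∷ dA
  , +-mono-≤-< l≤l′ (n<1+n (length ls)) ∷ dB
  , match (≤-trans (≤-reflexive (trans (+-suc m′ (length ms)) (cong (suc m′ +_) (suc-injective e))))
           (+-monoˡ-≤ (length ls) m′<l)) d

unβ-overlapping : ∀ {b A B} → Decr b A → Decr b B → Dominates 0 A B → Overlapping (unβ (b ∷ B)) (unβ A)
unβ-overlapping (p ∷ []) [] base = single p
unβ-overlapping {b} {a ∷ a′ ∷ A} {b′ ∷ B} (p ∷ (a′<a ∷ dA)) (b′<b ∷ dB) (match a≤b′ d) = cons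
  (∸-monoˡ-≤ (suc (length B)) b′<b)
  (∸-monoˡ-≤ (suc (length A)) a′<a)
  -- The strictness of the overlap comes from the shift of `a` being one more than that of `b′`;
  -- `|B|<a` keeps the subtraction exact.
  (subst (_≤ b′ ∸ length B)
    (trans (+-∸-assoc 1 |B|<a) (cong (λ n → suc (a ∸ n)) (sym |A|)))
    (∸-monoˡ-≤ (length B) a≤b′))
  (unβ-overlapping (<-≤-trans a′<a a≤b′ ∷ dA) dB d)
  where
  |A| : suc (length A) ≡ suc (length B)
  |A| = dominates⇒length d
  |B|<a : suc (length B) ≤ a
  |B|<a = subst (_≤ a) |A| (Decr⇒length≤ (a′<a ∷ dA))

-- Cell tests and the perimeter.

⌊⌋-true : {P : Set} (P? : Dec P) → P → ⌊ P? ⌋ ≡ true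
⌊⌋-true (yes _) p = refl
⌊⌋-true (no ¬p) p = ⊥-elim (¬p p)

⌊⌋-false : {P : Set} (P? : Dec P) → ¬ P → ⌊ P? ⌋ ≡ false
⌊⌋-false (yes p) ¬p = ⊥-elim (¬p p)
⌊⌋-false (no _)  ¬p = refl

⌊⌋-true⁻¹ : {P : Set} (P? : Dec P) → ⌊ P? ⌋ ≡ true → P
⌊⌋-true⁻¹ (yes p) _ = p

∧-true⁻¹ : ∀ x {y} → x ∧ y ≡ true → x ≡ true × y ≡ true
∧-true⁻¹ true e = refl , e

inSkew-true : ∀ ls ms i j → InSkew ls ms (i , j) → inSkew ls ms i j ≡ true
inSkew-true ls ms i j (p , q) = cong₂ _∧_ (⌊⌋-true (part ms i <? j) p) (⌊⌋-true (j ≤? part ls i) q)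

inSkew-true⁻¹ : ∀ ls ms i j → inSkew ls ms i j ≡ true → InSkew ls ms (i , j)
inSkew-true⁻¹ ls ms i j e = let p , q = ∧-true⁻¹ ⌊ part ms i <? j ⌋ e in
  ⌊⌋-true⁻¹ (part ms i <? j) p , ⌊⌋-true⁻¹ (j ≤? part ls i) q

not-inSkew-true : ∀ ls ms i j → ¬ InSkew ls ms (i , j) → not (inSkew ls ms i j) ≡ true
not-inSkew-true ls ms i j ¬x with inSkew ls ms i j in e
... | true  = ⊥-elim (¬x (inSkew-true⁻¹ ls ms i j e))
... | false = refl

not-inSkew-true⁻¹ : ∀ ls ms i j → not (inSkew ls ms i j) ≡ true → ¬ InSkew ls ms (i , j)
not-inSkew-true⁻¹ ls ms i j e x with inSkew ls ms i j | inSkew-true ls ms i j x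
not-inSkew-true⁻¹ ls ms i j () x | true | refl

count-all : ∀ p f n → (∀ i → i < n → p (f i) ≡ true) → count p (applyUpTo f n) ≡ n
count-all p f zero    h = refl
count-all p f (suc n) h with p (f 0) | h 0 (s≤s z≤n)
... | true | refl = cong suc (count-all p (f ∘ suc) n (λ i i<n → h (suc i) (s≤s i<n)))

row-nonempty : ∀ {ls ms} → Overlapping ls ms → ∀ i → i < length ls → part ms (suc i) < part ls (suc i)
row-nonempty (single p)     zero    _       = p
row-nonempty (single p)     (suc i) (s≤s ())
row-nonempty (cons p q r o) zero    _       = <-≤-trans r p
row-nonempty (cons p q r o) (suc i) (s≤s i<) = row-nonempty o i i<

rows-overlap : ∀ {ls ms} → Overlapping ls ms → ∀ i → suc i < length ls → part ms (suc i) < part ls (suc (suc i))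
rows-overlap (single p)     i       (s≤s ())
rows-overlap (cons p q r o) zero    _        = r
rows-overlap (cons p q r o) (suc i) (s≤s i<) = rows-overlap o i i<

-- The witness is the last row reaching column `j`: if the next row ends before `j`, overlap makes
-- this row start before `j` too.
column-nonempty : ∀ {ls ms} → Overlapping ls ms → ∀ j → 0 < j → j ≤ part ls 1 →
  Σ ℕ (λ i → i < length ls × InSkew ls ms (suc i , j))
column-nonempty (single p) j 0<j j≤l = 0 , ≤-refl , 0<j , j≤l
column-nonempty (cons {l = l} p q r o) j 0<j j≤l′ with j ≤? l
... | yes j≤l = let i , i< , x = column-nonempty o j 0<j j≤l in suc i , s≤s i< , x
... | no  j≰l = 0 , s≤s z≤n , <-trans r (≰⇒> j≰l) , j≤l′

part-mono : ∀ {xs} → Decreasing xs → ∀ i → part xs (suc (suc i)) ≤ part xs (suc i)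
part-mono []       i       = z≤n
part-mono [-]      i       = z≤n
part-mono (p ∷ d)  zero    = p
part-mono (p ∷ d)  (suc i) = part-mono d i

part≤part1 : ∀ {xs} → Decreasing xs → ∀ i → part xs (suc i) ≤ part xs 1
part≤part1 d zero    = ≤-refl
part≤part1 d (suc i) = ≤-trans (part-mono d i) (part≤part1 d i)

-- Names the auxiliary function local to numCols: abstracting the list of rows
-- turns the equation for the metavariable into a pattern unification problem.
mutual
  anyRow : ConnectedSkew → List ℕ → ℕ → Bool
  anyRow = _

  numCols-anyRow : ∀ D → numCols D ≡ count (λ j → anyRow D (range1 (length (lam D))) j) (range1 (part (lam D) 1))
  numCols-anyRow D with range1 (length (lam D))
  ... | is = refl

anyRow-true : ∀ D f n {i j} → i < n → InSkew (lam D) (mu D) (f i , j) → anyRow D (applyUpTo f n) j ≡ true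
anyRow-true D f (suc n) {zero} {j} i<n x rewrite inSkew-true (lam D) (mu D) (f 0) j x = refl
anyRow-true D f (suc n) {suc i} {j} (s≤s i<n) x with inSkew (lam D) (mu D) (f 0) j
... | true  = refl
... | false = anyRow-true D (f ∘ suc) n i<n x

perimeter≡ : ∀ D → perimeter D ≡ 2 * (length (lam D) + part (lam D) 1)
perimeter≡ D = cong (2 *_) (cong₂ _+_
  (count-all _ suc (length (lam D)) (λ i i< → ⌊⌋-true (_ <? _) (row-nonempty o i i<)))
  (trans (numCols-anyRow D) (count-all _ suc (part (lam D) 1) (λ j j< →
    let i , i< , x = column-nonempty o (suc j) (s≤s z≤n) j< in anyRow-true D suc (length (lam D)) i< x))))
  where
  o = connectedSkew-overlapping D

-- Diagonal lengths.

-- The diagonal starting in column j of the first row, ignoring μ: a diagonal that starts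
-- inside λ/μ can only leave it through the boundary of λ.
diagonal : List ℕ → ℕ → ℕ
diagonal []       j = 0
diagonal (l ∷ ls) j = if ⌊ j ≤? l ⌋ then suc (diagonal ls (suc j)) else 0

diagonal-≤ : ∀ {l j} ls → j ≤ l → diagonal (l ∷ ls) j ≡ suc (diagonal ls (suc j))
diagonal-≤ {l} {j} ls j≤l rewrite ⌊⌋-true (j ≤? l) j≤l = refl

diagonal-> : ∀ {l j} ls → l < j → diagonal (l ∷ ls) j ≡ 0
diagonal-> {l} {j} ls l<j rewrite ⌊⌋-false (j ≤? l) (<⇒≱ l<j) = refl

diagonal-drop : ∀ ls p j → 0 < j →
  diagonal (drop p ls) j ≡ (if ⌊ j ≤? part ls (suc p) ⌋ then suc (diagonal (drop (suc p) ls) (suc j)) else 0)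
diagonal-drop []       zero    j 0<j rewrite ⌊⌋-false (j ≤? 0) (<⇒≱ 0<j) = refl
diagonal-drop []       (suc p) j 0<j rewrite ⌊⌋-false (j ≤? 0) (<⇒≱ 0<j) = refl
diagonal-drop (l ∷ ls) zero    j 0<j = refl
diagonal-drop (l ∷ ls) (suc p) j 0<j = diagonal-drop ls p j 0<j

drop-all : ∀ (ls : List ℕ) p → length ls ≤ p → drop p ls ≡ []
drop-all []       zero    _       = refl
drop-all []       (suc p) _       = refl
drop-all (l ∷ ls) (suc p) (s≤s q) = drop-all ls p q

-- The bound on `f` lets the fuel run out only below the last row, where both lengths are 0. The
-- test against `mu` keeps succeeding because columns increase and the parts of `mu` do not.
diagLen≡ : ∀ D f p j → length (lam D) ≤ f + p → part (mu D) (suc p) < j →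
  diagLen D f (suc p) j ≡ diagonal (drop p (lam D)) j
diagLen≡ D zero    p j len m<j = sym (cong (λ ls → diagonal ls j) (drop-all (lam D) p len))
diagLen≡ D (suc f) p j len m<j
  rewrite diagonal-drop (lam D) p j (≤-<-trans z≤n m<j) | ⌊⌋-true (part (mu D) (suc p) <? j) m<j
  | diagLen≡ D f (suc p) (suc j) (subst (length (lam D) ≤_) (sym (+-suc f p)) len)
      (<-trans (≤-<-trans (part-mono (overlapping⇒mu-partition (connectedSkew-overlapping D)) p) m<j) (n<1+n j))
  = refl

diag≡ : ∀ D p j → part (mu D) (suc p) < j → diag D (suc p) j ≡ diagonal (drop p (lam D)) j
diag≡ D p j = diagLen≡ D (suc (length (lam D))) p j (≤-trans (n≤1+n _) (m≤m+n _ p))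

β-Decr : ∀ {l ls} → Decreasing (l ∷ ls) → Decr (suc (l + length ls)) (β (l ∷ ls))
β-Decr [-] = ≤-refl ∷ []
β-Decr {l} (_∷_ {y = l₂} {xs = ls} l₂≤l d) with β-Decr d
... | _ ∷ e = ≤-refl ∷ +-mono-≤-< l₂≤l (n<1+n (length ls)) ∷ e

-- `diagonal ls (suc m)` counts the entries of `β ls` that are at least `m + length ls`, since its
-- cell in a row is present exactly when the shifted entry of that row reaches this value. Starting
-- one column further right thus loses a cell precisely when the value itself is an entry.
diagonal-shift : ∀ {ls} → Decreasing ls → ∀ m →
  suc (diagonal ls (suc (suc m))) ≡ diagonal ls (suc m) + absence (m + length ls) (β ls)
diagonal-shift {[]}     d m = refl
diagonal-shift {l ∷ ls} d m with <-cmp l (suc m)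
... | tri< l≤m _ _ = begin
  suc (diagonal (l ∷ ls) (suc (suc m))) ≡⟨ cong suc (diagonal-> ls (<-trans l≤m (n<1+n _))) ⟩
  1 ≡⟨ sym (absence-Decr (β-Decr d)
         (≤-trans (+-monoˡ-≤ (length ls) l≤m) (≤-reflexive (sym (+-suc m (length ls)))))) ⟩
  absence (m + suc (length ls)) (β (l ∷ ls))
    ≡⟨ cong (_+ absence (m + suc (length ls)) (β (l ∷ ls))) (sym (diagonal-> ls l≤m)) ⟩
  diagonal (l ∷ ls) (suc m) + absence (m + suc (length ls)) (β (l ∷ ls)) ∎
  where open ≡-Reasoning
... | tri≈ _ refl _ = begin
  suc (diagonal (l ∷ ls) (suc (suc m))) ≡⟨ cong suc (diagonal-> ls ≤-refl) ⟩
  1 ≡⟨ cong suc (sym (next d)) ⟩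
  suc (diagonal ls (suc (suc m))) ≡⟨ sym (diagonal-≤ ls ≤-refl) ⟩
  diagonal (l ∷ ls) (suc m) ≡⟨ sym (+-identityʳ _) ⟩
  diagonal (l ∷ ls) (suc m) + 0
    ≡⟨ cong (diagonal (l ∷ ls) (suc m) +_) (sym (absence-here _ (β ls))) ⟩
  diagonal (l ∷ ls) (suc m) + absence (l + length ls) (β (l ∷ ls))
    ≡⟨ cong (λ v → diagonal (l ∷ ls) (suc m) + absence v (β (l ∷ ls))) (sym (+-suc m (length ls))) ⟩
  diagonal (l ∷ ls) (suc m) + absence (m + suc (length ls)) (β (l ∷ ls)) ∎
  where
  open ≡-Reasoning
  next : ∀ {ls} → Decreasing (suc m ∷ ls) → diagonal ls (suc (suc m)) ≡ 0
  next [-] = refl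
  next (_∷_ {xs = ls} p _) = diagonal-> ls (s≤s p)
... | tri> _ l≢ m<l = begin
  suc (diagonal (l ∷ ls) (suc (suc m))) ≡⟨ cong suc (diagonal-≤ ls m<l) ⟩
  suc (suc (diagonal ls (suc (suc (suc m))))) ≡⟨ cong suc (diagonal-shift (Linked.tail d) (suc m)) ⟩
  suc (diagonal ls (suc (suc m))) + absence (suc m + length ls) (β ls)
    ≡⟨ cong₂ _+_ (sym (diagonal-≤ ls (<⇒≤ m<l)))
         (sym (absence-there (β ls) λ e → l≢ (sym (+-cancelʳ-≡ (length ls) (suc m) l e)))) ⟩
  diagonal (l ∷ ls) (suc m) + absence (suc m + length ls) (β (l ∷ ls))
    ≡⟨ cong (λ v → diagonal (l ∷ ls) (suc m) + absence v (β (l ∷ ls))) (sym (+-suc m (length ls))) ⟩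
  diagonal (l ∷ ls) (suc m) + absence (m + suc (length ls)) (β (l ∷ ls)) ∎
  where open ≡-Reasoning

-- Lengths of the diagonals starting at the two ends of the vertical boundary step of row p + 1.
stepTop stepBottom : List ℕ → List ℕ → ℕ → ℕ
stepTop    ls ms p = diagonal (drop p ls) (suc (part ms (suc p)))
stepBottom ls ms p = diagonal (drop (suc p) ls) (suc (part ms (suc p)))

-- In each row but the last, the top diagonal has one cell in that row, and `diagonal-shift` trades
-- the rest for the bottom diagonal plus an indicator. The last row has a top diagonal of one cell,
-- which matches the forced 0 of A.
sum-steps : ∀ {l ls ms} → Overlapping (l ∷ ls) ms →
  sum (applyUpTo (stepTop (l ∷ ls) ms) (suc (length ls)))
    ≡ sum (applyUpTo (stepBottom (l ∷ ls) ms) (length ls)) + absences (β ms) (β ls)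
sum-steps (single p) rewrite diagonal-≤ [] p = refl
sum-steps (cons {l′} {l} {m′} {m} {ls} {ms} l≤l′ m≤m′ m′<l o) = begin
  diagonal (l′ ∷ L) (suc m′) + rest
    ≡⟨ cong (_+ rest) (diagonal-≤ L (<-≤-trans m′<l l≤l′)) ⟩
  suc (diagonal L (suc (suc m′))) + rest
    ≡⟨ cong₂ _+_ (diagonal-shift (proj₁ (overlapping⇒lam-partition o)) m′) (sum-steps o) ⟩
  (diagonal L (suc m′) + absence (m′ + length L) (β L)) + (rest′ + absences (β M) (β ls))
    ≡⟨ lem (diagonal L (suc m′)) _ rest′ _ ⟩
  (diagonal L (suc m′) + rest′) + (absence (m′ + length L) (β L) + absences (β M) (β ls))
    -- The head of `β L` exceeds every entry of `β M`, so including it leaves the indicators of the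
    -- later rows unchanged.
    ≡⟨ cong₂ (λ x y → (diagonal L (suc m′) + rest′) + (absence (m′ + x) (β L) + y))
         (sym (overlapping⇒length o)) (sym (absences-top (β ls) (proj₁ (β-overlapping o)))) ⟩
  (diagonal L (suc m′) + rest′) + absences (β (m′ ∷ M)) (β L) ∎
  where
  open ≡-Reasoning
  L = l ∷ ls
  M = m ∷ ms
  rest  = sum (applyUpTo (stepTop L M) (length L))
  rest′ = sum (applyUpTo (stepBottom L M) (length ls))
  lem : ∀ a b c d → (a + b) + (c + d) ≡ (a + c) + (b + d)
  lem = solve-∀

-- Corners row by row, and the rank.

sum-zero : ∀ (g : ℕ → ℕ) f n → (∀ i → i < n → g (f i) ≡ 0) → sum (map g (applyUpTo f n)) ≡ 0
sum-zero g f zero    h = refl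
sum-zero g f (suc n) h = cong₂ _+_ (h 0 (s≤s z≤n)) (sum-zero g (f ∘ suc) n (λ i i<n → h (suc i) (s≤s i<n)))

sum-single : ∀ (g : ℕ → ℕ) f n i₀ → i₀ < n → (∀ i → i ≢ i₀ → g (f i) ≡ 0) →
  sum (map g (applyUpTo f n)) ≡ g (f i₀)
sum-single g f (suc n) zero     _ h = trans
  (cong (g (f 0) +_) (sum-zero g (f ∘ suc) n (λ i _ → h (suc i) λ ()))) (+-identityʳ _)
sum-single g f (suc n) (suc i₀) (s≤s i₀<n) h = cong₂ _+_ (h 0 λ ())
  (sum-single g (f ∘ suc) n i₀ i₀<n (λ i i≢ → h (suc i) (i≢ ∘ suc-injective)))

sum-+ : ∀ (f g : ℕ → ℕ) n → sum (applyUpTo (λ i → f i + g i) n) ≡ sum (applyUpTo f n) + sum (applyUpTo g n)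
sum-+ f g zero    = refl
sum-+ f g (suc n) = trans (cong (f 0 + g 0 +_) (sum-+ (f ∘ suc) (g ∘ suc) n))
  (lem (f 0) (g 0) (sum (applyUpTo (f ∘ suc) n)) (sum (applyUpTo (g ∘ suc) n)))
  where
  lem : ∀ a b c d → (a + b) + (c + d) ≡ (a + c) + (b + d)
  lem = solve-∀

sum-cong : ∀ (f g : ℕ → ℕ) n → (∀ i → i < n → f i ≡ g i) → sum (applyUpTo f n) ≡ sum (applyUpTo g n)
sum-cong f g zero    h = refl
sum-cong f g (suc n) h = cong₂ _+_ (h 0 (s≤s z≤n)) (sum-cong (f ∘ suc) (g ∘ suc) n (λ i i<n → h (suc i) (s≤s i<n)))

module Rank (D : ConnectedSkew) where
  private
    ls = lam D
    ms = mu D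
    o : Overlapping ls ms
    o = connectedSkew-overlapping D
    dl : Decreasing ls
    dl = proj₁ (overlapping⇒lam-partition o)
    dm : Decreasing ms
    dm = overlapping⇒mu-partition o

  row : (ℕ → ℕ → Bool) → ℕ → ℕ
  row p i = sum (map (λ j → if p i j then diag D i j else 0) (range1 (part ls 1)))

  sumCells≡ : ∀ p → sumCells D p ≡ sum (applyUpTo (row p ∘ suc) (length ls))
  sumCells≡ p = cong sum (map-applyUpTo suc (row p) (length ls))

  row-single : ∀ p i t → t < part ls 1 → p i (suc t) ≡ true → (∀ s → p i (suc s) ≡ true → s ≡ t) →
    row p i ≡ diag D i (suc t)
  row-single p i t t< e u = trans
    (sum-single _ suc (part ls 1) t t< off)
    (cong (λ b → if b then diag D i (suc t) else 0) e)
    where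
    off : ∀ s → s ≢ t → (if p i (suc s) then diag D i (suc s) else 0) ≡ 0
    off s s≢t with p i (suc s) in es
    ... | true  = ⊥-elim (s≢t (u s es))
    ... | false = refl

  row-zero : ∀ p i → (∀ s → p i (suc s) ≢ true) → row p i ≡ 0
  row-zero p i u = sum-zero _ suc (part ls 1) off
    where
    off : ∀ s → s < part ls 1 → (if p i (suc s) then diag D i (suc s) else 0) ≡ 0
    off s _ with p i (suc s) in es
    ... | true  = ⊥-elim (u s es)
    ... | false = refl

  outsideTop-true⁻¹ : ∀ i j → outsideTop D i j ≡ true →
    InSkew ls ms (i , j) × ¬ InSkew ls ms (i ∸ 1 , j) × ¬ InSkew ls ms (i , j ∸ 1)
  outsideTop-true⁻¹ i j e =
    let x , e′ = ∧-true⁻¹ (inSkew ls ms i j) e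
        y , z  = ∧-true⁻¹ (not (inSkew ls ms (i ∸ 1) j)) e′
    in inSkew-true⁻¹ ls ms i j x , not-inSkew-true⁻¹ ls ms (i ∸ 1) j y , not-inSkew-true⁻¹ ls ms i (j ∸ 1) z

  outsideTop-true : ∀ i j →
    InSkew ls ms (i , j) → ¬ InSkew ls ms (i ∸ 1 , j) → ¬ InSkew ls ms (i , j ∸ 1) → outsideTop D i j ≡ true
  outsideTop-true i j x y z = cong₂ _∧_ (inSkew-true ls ms i j x)
    (cong₂ _∧_ (not-inSkew-true ls ms (i ∸ 1) j y) (not-inSkew-true ls ms i (j ∸ 1) z))

  insideTop-true⁻¹ : ∀ i j → insideTop D i j ≡ true →
    InSkew ls ms (i ∸ 1 , j) × InSkew ls ms (i , j ∸ 1) × ¬ InSkew ls ms (i ∸ 1 , j ∸ 1)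
  insideTop-true⁻¹ i j e =
    let _ , e₁ = ∧-true⁻¹ (inSkew ls ms i j) e
        x , e₂ = ∧-true⁻¹ (inSkew ls ms (i ∸ 1) j) e₁
        y , z  = ∧-true⁻¹ (inSkew ls ms i (j ∸ 1)) e₂
    in inSkew-true⁻¹ ls ms (i ∸ 1) j x , inSkew-true⁻¹ ls ms i (j ∸ 1) y , not-inSkew-true⁻¹ ls ms (i ∸ 1) (j ∸ 1) z

  insideTop-true : ∀ i j → InSkew ls ms (i , j) → InSkew ls ms (i ∸ 1 , j) → InSkew ls ms (i , j ∸ 1) →
    ¬ InSkew ls ms (i ∸ 1 , j ∸ 1) → insideTop D i j ≡ true
  insideTop-true i j w x y z = cong₂ _∧_ (inSkew-true ls ms i j w) (cong₂ _∧_ (inSkew-true ls ms (i ∸ 1) j x)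
    (cong₂ _∧_ (inSkew-true ls ms i (j ∸ 1) y) (not-inSkew-true ls ms (i ∸ 1) (j ∸ 1) z)))

  outside-column : ∀ i s → outsideTop D i (suc s) ≡ true → s ≡ part ms i
  outside-column i s e = let (m≤s , s<l) , _ , z = outsideTop-true⁻¹ i (suc s) e in
    ≤-antisym (≮⇒≥ λ m<s → z (m<s , <⇒≤ s<l)) (s≤s⁻¹ m≤s)

  inside-column : ∀ q s → insideTop D (suc (suc q)) (suc s) ≡ true →
    s ≡ part ms (suc q) × part ms (suc (suc q)) < part ms (suc q)
  inside-column q s e =
    let (m≤s , s<l) , (m′<s , _) , z = insideTop-true⁻¹ (suc (suc q)) (suc s) e
        s≡m = ≤-antisym (≮⇒≥ λ m<s → z (m<s , <⇒≤ s<l)) (s≤s⁻¹ m≤s)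
    in s≡m , subst (part ms (suc (suc q)) <_) s≡m m′<s

  top-row-outside : 0 < length ls → row (outsideTop D) 1 ≡ diag D 1 (suc (part ms 1))
  top-row-outside 0<k = row-single (outsideTop D) 1 (part ms 1) m<l
    (outsideTop-true 1 (suc (part ms 1)) (≤-refl , m<l) (¬InSkew-row0 ls ms _) (<-irrefl refl ∘ proj₁))
    (outside-column 1)
    where m<l = row-nonempty o 0 0<k

  top-row-inside : row (insideTop D) 1 ≡ 0
  top-row-inside = row-zero (insideTop D) 1
    (λ s e → ¬InSkew-row0 ls ms _ (proj₁ (insideTop-true⁻¹ 1 (suc s) e)))

  -- If the parts of `mu` in the two rows differ, row `i` has one outside corner just after its own
  -- part and one inside corner just after the part above, so the added diagonals complete both
  -- sides crosswise. If they agree, row `i` has no corner and the added diagonals coincide.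
  row-balance : ∀ q → suc q < length ls → let i = suc (suc q) in
    row (outsideTop D) i + diag D i (suc (part ms (suc q))) ≡ row (insideTop D) i + diag D i (suc (part ms i))
  row-balance q q< with part ms (suc (suc q)) <? part ms (suc q)
  ... | yes m<m′ = trans (cong₂ _+_ out refl) (trans (+-comm (diag D i (suc m)) _) (cong₂ _+_ (sym ins) refl))
    where
    i  = suc (suc q)
    m  = part ms i
    m′ = part ms (suc q)
    m′<l : m′ < part ls i
    m′<l = rows-overlap o q q<
    l≤l′ : part ls i ≤ part ls (suc q)
    l≤l′ = part-mono dl q
    m<l : m < part ls i
    m<l = <-trans m<m′ m′<l
    out : row (outsideTop D) i ≡ diag D i (suc m)
    out = row-single (outsideTop D) i m (<-≤-trans m<l (part≤part1 dl (suc q)))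
      (outsideTop-true i (suc m) (≤-refl , m<l) (λ x → <⇒≱ (proj₁ x) m<m′) (<-irrefl refl ∘ proj₁))
      (outside-column i)
    ins : row (insideTop D) i ≡ diag D i (suc m′)
    ins = row-single (insideTop D) i m′ (<-≤-trans m′<l (part≤part1 dl (suc q)))
      (insideTop-true i (suc m′) (<-trans m<m′ (n<1+n m′) , m′<l) (≤-refl , ≤-trans m′<l l≤l′)
        (m<m′ , <⇒≤ m′<l) (<-irrefl refl ∘ proj₁))
      (λ s e → proj₁ (inside-column q s e))
  ... | no m≮m′ = cong₂ _+_
    (trans (row-zero (outsideTop D) i out) (sym (row-zero (insideTop D) i (λ s e → m≮m′ (proj₂ (inside-column q s e))))))
    (cong (λ m → diag D i (suc m)) (sym m≡m′))
    where
    i = suc (suc q)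
    m≡m′ : part ms i ≡ part ms (suc q)
    m≡m′ = ≤-antisym (part-mono dm q) (≮⇒≥ m≮m′)
    out : ∀ s → outsideTop D i (suc s) ≢ true
    out s e = let (m<j , j≤l) , y , _ = outsideTop-true⁻¹ i (suc s) e in
      y (subst (_< suc s) m≡m′ m<j , ≤-trans j≤l (part-mono dl q))

  -- Summation by parts: corners of μ are traded for its vertical boundary steps.
  balance : ∀ k → length ls ≡ suc k →
    sumCells D (outsideTop D) + sum (applyUpTo (stepBottom ls ms) k)
      ≡ sumCells D (insideTop D) + sum (applyUpTo (stepTop ls ms) (suc k))
  balance k |ls| = begin
    sumCells D (outsideTop D) + E
      ≡⟨ cong (_+ E) (trans (sumCells≡ (outsideTop D)) (cong (sum ∘ applyUpTo _) |ls|)) ⟩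
    (row (outsideTop D) 1 + X) + E
      ≡⟨ cong (λ x → (x + X) + E) (trans (top-row-outside (subst (0 <_) (sym |ls|) (s≤s z≤n)))
           (diag≡ D 0 _ ≤-refl)) ⟩
    (T₀ + X) + E
      ≡⟨ +-assoc T₀ X E ⟩
    T₀ + (X + E)
      ≡⟨ cong (T₀ +_) (trans (sym (sum-+ _ (stepBottom ls ms) k)) (trans (sum-cong _ _ k pointwise)
           (sum-+ _ (stepTop ls ms ∘ suc) k))) ⟩
    T₀ + (Y + T)
      ≡⟨ lem T₀ Y T ⟩
    Y + (T₀ + T)
      ≡⟨ cong (λ x → (x + Y) + (T₀ + T)) (sym top-row-inside) ⟩
    (row (insideTop D) 1 + Y) + (T₀ + T)
      ≡⟨ cong (_+ (T₀ + T)) (sym (trans (sumCells≡ (insideTop D)) (cong (sum ∘ applyUpTo _) |ls|))) ⟩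
    sumCells D (insideTop D) + (T₀ + T) ∎
    where
    open ≡-Reasoning
    T₀ = stepTop ls ms 0
    E = sum (applyUpTo (stepBottom ls ms) k)
    T = sum (applyUpTo (stepTop ls ms ∘ suc) k)
    X = sum (applyUpTo (λ q → row (outsideTop D) (suc (suc q))) k)
    Y = sum (applyUpTo (λ q → row (insideTop D) (suc (suc q))) k)
    lem : ∀ a b c → a + (b + c) ≡ b + (a + c)
    lem = solve-∀
    -- The bottom end of one vertical step lies in the same row as the top end of the next, so
    -- `row-balance` pairs them; only the first top end `T₀` is left over.
    pointwise : ∀ q → q < k → row (outsideTop D) (suc (suc q)) + stepBottom ls ms q
      ≡ row (insideTop D) (suc (suc q)) + stepTop ls ms (suc q)
    pointwise q q<k = trans
      (cong (row (outsideTop D) (suc (suc q)) +_) (sym (diag≡ D (suc q) _ (s≤s (part-mono dm q)))))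
      (trans (row-balance q (subst (suc q <_) (sym |ls|) (s≤s q<k)))
        (cong (row (insideTop D) (suc (suc q)) +_) (diag≡ D (suc q) _ ≤-refl)))

-- Opened only here, since +_ clashes with left sections of addition.
open import Data.Integer using (+_)

-- `Rank.balance` turns the rank into top diagonals minus bottom diagonals, and `sum-steps`
-- evaluates that difference.
rank≡ : ∀ D {l ls} → lam D ≡ l ∷ ls → rank D ≡ + absences (β (mu D)) (β ls)
rank≡ D {l} {ls} e = begin
  + out ℤ.- + ins         ≡⟨ cong (λ x → + x ℤ.- + ins) out≡ ⟩
  + (ins + a) ℤ.- + ins   ≡⟨ ℤₚ.m-n≡m⊖n (ins + a) ins ⟩
  (ins + a) ℤ.⊖ ins       ≡⟨ ℤₚ.⊖-≥ (m≤m+n ins a) ⟩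
  + (ins + a ∸ ins)       ≡⟨ cong +_ (m+n∸m≡n ins a) ⟩
  + a                     ∎
  where
  open ≡-Reasoning
  out = sumCells D (outsideTop D)
  ins = sumCells D (insideTop D)
  a   = absences (β (mu D)) (β ls)
  E   = sum (applyUpTo (stepBottom (lam D) (mu D)) (length ls))
  steps : sum (applyUpTo (stepTop (lam D) (mu D)) (suc (length ls))) ≡ E + a
  steps = subst (λ L → sum (applyUpTo (stepTop L (mu D)) (suc (length ls)))
      ≡ sum (applyUpTo (stepBottom L (mu D)) (length ls)) + a) (sym e)
    (sum-steps (subst (λ L → Overlapping L (mu D)) e (connectedSkew-overlapping D)))
  out≡ : out ≡ ins + a
  out≡ = +-cancelʳ-≡ E out (ins + a) (trans (Rank.balance D (length ls) (cong length e))
    (trans (cong (λ x → ins + x) steps) (lem ins E a)))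
    where
    lem : ∀ i e a → i + (e + a) ≡ (i + a) + e
    lem = solve-∀

-- The bijection between paths and diagrams.

wordSkew : ∀ {n} → Word 0 n → ConnectedSkew
wordSkew {n} w = fromOverlapping (unβ (suc n ∷ lower w)) (unβ (upper w))
  (unβ-overlapping (upper-Decr w) (lower-Decr w) (dominates w))

perimeter-wordSkew : ∀ {n} (w : Word 0 n) → perimeter (wordSkew w) ≡ 2 * suc n + 2
perimeter-wordSkew {n} w = begin
  perimeter (wordSkew w)
    ≡⟨ perimeter≡ (wordSkew w) ⟩
  2 * suc (length (unβ (lower w)) + (suc n ∸ length (lower w)))
    ≡⟨ cong (λ x → 2 * suc (x + (suc n ∸ length (lower w)))) (length-unβ (lower w)) ⟩
  2 * suc (length (lower w) + (suc n ∸ length (lower w)))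
    ≡⟨ cong (λ x → 2 * suc x) (m+[n∸m]≡n (Decr⇒length≤ (lower-Decr w))) ⟩
  2 * suc (suc n)
    ≡⟨ lem n ⟩
  2 * suc n + 2 ∎
  where
  open ≡-Reasoning
  lem : ∀ n → 2 * suc (suc n) ≡ 2 * suc n + 2
  lem = solve-∀

rank-wordSkew : ∀ {n} (w : Word 0 n) → rank (wordSkew w) ≡ + suc (ups w)
rank-wordSkew w = trans (rank≡ (wordSkew w) refl) (cong +_ (begin
  absences (β (unβ (upper w))) (β (unβ (lower w)))
    ≡⟨ cong₂ absences (β-unβ (upper-Decr w)) (β-unβ (lower-Decr w)) ⟩
  absences (upper w) (lower w) ≡⟨ absences-word w ⟩
  suc (ups w + 0)              ≡⟨ cong suc (+-identityʳ (ups w)) ⟩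
  suc (ups w)                  ∎))
  where open ≡-Reasoning

wordSkew-injective : ∀ {n} {w w′ : Word 0 n} → wordSkew w ≡ wordSkew w′ → w ≡ w′
wordSkew-injective {w = w} {w′} e = word-injective w w′
  (unβ-injective (upper-Decr w) (upper-Decr w′) (cong mu e))
  (unβ-injective (lower-Decr w) (lower-Decr w′) (∷-injectiveʳ (cong lam e)))

wordSkew-surjective : ∀ {n} D → perimeter D ≡ 2 * suc n + 2 → Σ (Word 0 n) (λ w → wordSkew w ≡ D)
wordSkew-surjective {n} D e = go (lam D) (mu D) refl refl (connectedSkew-overlapping D)
  where
  go : ∀ L ms → lam D ≡ L → mu D ≡ ms → Overlapping L ms → Σ (Word 0 n) (λ w → wordSkew w ≡ D)
  go (l ∷ ls) ms refl refl o =
    let dA , dB , d = β-overlapping o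
        w , eA , eB = word-surjective n (subst (λ b → Decr b (β ms)) size dA) (subst (λ b → Decr b (β ls)) size dB) d
    in w , ConnectedSkew-≡
      (cong₂ _∷_ (trans (cong (λ B → suc n ∸ length B) eB) head≡) (trans (cong unβ eB) (unβ-β ls)))
      (trans (cong unβ eA) (unβ-β ms))
    where
    lem₁ : ∀ n → 2 * suc n + 2 ≡ 2 * suc (suc n)
    lem₁ = solve-∀
    -- The perimeter fixes the forced maximum of B, since it counts the rows and the largest part.
    size : l + length ls ≡ suc n
    size = trans (+-comm l (length ls)) (suc-injective (*-cancelˡ-≡ _ _ 2
      (trans (sym (perimeter≡ D)) (trans e (lem₁ n)))))
    head≡ : suc n ∸ length (β ls) ≡ l
    head≡ = trans (cong₂ _∸_ (sym size) (length-β ls)) (m+n∸n≡m l (length ls))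

Σ-≡ : {A : Set} {P : A → Set} → (∀ a (p q : P a) → p ≡ q) →
  {x y : Σ A P} → proj₁ x ≡ proj₁ y → x ≡ y
Σ-≡ irrelevant {a , p} {_ , q} refl = cong (a ,_) (irrelevant a p q)

WordUps↔ConnectedSkew : ∀ n k →
  WordUps 0 n k ↔ Σ ConnectedSkew (λ D → (perimeter D ≡ 2 * suc n + 2) × (rank D ≡ + suc k))
WordUps↔ConnectedSkew n k = ⤖⇒↔ (mk⤖ {to = to} (injective , strictlySurjective⇒surjective surjective))
  where
  Target : Set
  Target = Σ ConnectedSkew (λ D → (perimeter D ≡ 2 * suc n + 2) × (rank D ≡ + suc k))
  to : WordUps 0 n k → Target
  to (w , e) = wordSkew w , perimeter-wordSkew w , trans (rank-wordSkew w) (cong (λ x → + suc x) e)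
  injective : Injective _≡_ _≡_ to
  injective p = Σ-≡ (λ _ → ≡-irrelevant) (wordSkew-injective (cong proj₁ p))
  irrelevant : ∀ D (x y : (perimeter D ≡ 2 * suc n + 2) × (rank D ≡ + suc k)) → x ≡ y
  irrelevant D (p , q) (p′ , q′) = cong₂ _,_ (≡-irrelevant p p′) (Decidable⇒UIP.≡-irrelevant ℤ._≟_ q q′)
  surjective : StrictlySurjective _≡_ to
  surjective (D , p , q) =
    let w , e = wordSkew-surjective D p
    in (w , suc-injective (ℤₚ.+-injective (trans (sym (rank-wordSkew w)) (trans (cong rank e) q)))) , Σ-≡ irrelevant e

theorem5p11 : (n r : ℕ) → n ≥ 1 → r ≥ 1 →
    Fin (2 ^ (n + 1 ∸ 2 * r) * ((n ∸ 1) C (2 * r ∸ 2)) * catalan (r ∸ 1))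
    ↔ Σ ConnectedSkew (λ D → (perimeter D ≡ 2 * n + 2) × (rank D ≡ + r))
theorem5p11 (suc n) (suc k) _ _ =
  subst (λ N → Fin N ↔ Σ ConnectedSkew (λ D → (perimeter D ≡ 2 * suc n + 2) × (rank D ≡ + suc k))) size
    (WordUps↔ConnectedSkew n k ↔-∘ Fin↔WordUps 0 n k)
  where
  2*suc : 2 * suc k ≡ suc (suc (2 * k))
  2*suc = *-suc 2 k
  size : #words 0 n k ≡ 2 ^ (suc n + 1 ∸ 2 * suc k) * (n C (2 * suc k ∸ 2)) * catalan k
  -- Both arguments of the truncated subtraction carry the same 2, so the exponent is `n ∸ 2 * k`
  -- whatever the sizes.
  size = trans (#words-catalan n k) (cong₂ (λ i j → 2 ^ i * (n C j) * catalan k)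
    (sym (cong₂ _∸_ (cong suc (+-comm n 1)) 2*suc)) (sym (cong (_∸ 2) 2*suc)))
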